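{- Let $d,k\ge 1$, let $P\subseteq\mathbb{R}^d$ be a $d$-dimensional lattice polytope with $h^*$-vector $(h_0^*(P),\dots,h_d^*(P))$, and let $\mathbf{P}=(P,\dots,P)$ be the collection of $k$ copies of $P$. Then $$\mathrm{ME}_{\mathbf{P}}(n)=\sum_{j=0}^d\left(\sum_{i=0}^k(-1)^{k-i}\binom{k}{i}\binom{in+d-j}{d}\right)h_j^*(P).$$ In particular, $$\mathrm{DMV}(\mathbf{P})=\sum_{j=0}^d\binom{d-j}{d-k}h_j^*(P).$$
   Context: A lattice polytope in $\mathbb{R}^d$ is the convex hull of a nonempty finite subset of $\mathbb{Z}^d$. For a lattice polytope $P$, $E_P(n)$ is its Ehrhart polynomial, i.e. the polynomial with $E_P(n)=|nP\cap\mathbb{Z}^d|$ for all integers $n\ge 0$. For a $d$-dimensional lattice polytope $P\subseteq\mathbb{R}^d$, the $h^*$-vector $(h_0^*(P),\dots,h_d^*(P))$ is defined by $$E_P(n)=\sum_{j=0}^d h_j^*(P)\binom{n+d-j}{d}.$$ For lattice polytopes $P_1,\dots,P_k\subseteq\mathbb{R}^d$ and $J\subseteq[k]=\{1,\dots,k\}$ put $P_J:=\sum_{j\in J}P_j$ (Minkowski sum), with $P_\emptyset=\{0\}$. The discrete mixed volume is $$\mathrm{DMV}(P_1,\dots,P_k):=\sum_{J\subseteq[k]}(-1)^{k-|J|}\,|P_J\cap\mathbb{Z}^d|,$$ and the mixed Ehrhart polynomial is $$\mathrm{ME}_{P_1,\dots,P_k}(n):=\mathrm{DMV}(nP_1,\dots,nP_k)=\sum_{J\subseteq[k]}(-1)^{k-|J|}E_{P_J}(n)\in\mathbb{Q}[n].$$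 The binomial coefficient $\binom{x}{d}=x(x-1)\cdots(x-d+1)/d!$ is regarded as a polynomial in $x$, and $\binom{m}{\ell}=0$ for $\ell<0$. -}

module Defs where

open import Data.Nat.Base as ℕ using (ℕ; zero; suc; _∸_; _!)
open import Data.Nat.Combinatorics using (_C_)
open import Data.Nat.Properties as ℕₚ using (_!≢0)
open import Data.Integer.Base as ℤ using (ℤ; +_; -[1+_]; -1ℤ)
open import Data.Rational.Base
  using (ℚ; 0ℚ; 1ℚ; ½; _+_; _*_; _-_; -_; _/_; ∣_∣; _<_; _≤_; 1/_; Positive; NonZero; positive; nonNegative)
open import Data.Rational.Properties as ℚₚ using ()
open import Data.Rational.Solver using (module +-*-Solver)
open import Data.Fin.Base using (Fin; toℕ)
open import Data.Fin.Subset using (Subset; inside; outside) renaming (∣_∣ to ∣_∣ₛ)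
open import Data.List.Base using (List; []; _∷_; length)
import Data.List.Base as List
open import Data.List.Membership.Propositional using (_∈_)
open import Data.List.Relation.Unary.Unique.Propositional using (Unique)
open import Data.Product.Base using (∃; _×_; _,_)
open import Data.Vec.Base using (Vec; []; _∷_; lookup; map)
import Data.Vec.Functional as F
open import Function.Bundles using (_⇔_)
open import Level using (0ℓ)
open import Relation.Binary.PropositionalEquality
  using (_≡_; refl; sym; trans; cong; cong₂; subst; subst₂)
open import Relation.Unary using (Pred)

open import Algebra.Properties.CommutativeMonoid.Sum ℚₚ.+-0-commutativeMonoid public
  using (sum; sum-syntax)

fromℤ : ℤ → ℚ
fromℤ z = z / 1

fromℕ : ℕ → ℚ
fromℕ n = fromℤ (+ n)

-- Real numbers as Cauchy sequences of rationals, with equality _≃_.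
-- Only the structure of an ordered ℚ-vector space is needed: every
-- product below has a rational factor.

record ℝ : Set where
  constructor real
  field
    seq    : ℕ → ℚ
    cauchy : ∀ ε → 0ℚ < ε →
             ∃ λ N → ∀ m n → N ℕ.≤ m → N ℕ.≤ n → ∣ seq m - seq n ∣ < ε

open ℝ public

infix 4 _≃_ _≤ᵣ_

_≃_ : ℝ → ℝ → Set
x ≃ y = ∀ ε → 0ℚ < ε → ∃ λ N → ∀ n → N ℕ.≤ n → ∣ seq x n - seq y n ∣ < ε

_≤ᵣ_ : ℝ → ℝ → Set
x ≤ᵣ y = ∀ ε → 0ℚ < ε → ∃ λ N → ∀ n → N ℕ.≤ n → seq x n < seq y n + ε

fromℚ : ℚ → ℝ
fromℚ q = real (λ _ → q) λ ε ε>0 →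
  0 , λ _ _ _ _ → subst (_< ε) (sym (cong ∣_∣ (ℚₚ.+-inverseʳ q))) ε>0

0ℝ 1ℝ : ℝ
0ℝ = fromℚ 0ℚ
1ℝ = fromℚ 1ℚ

private
  half-pos : ∀ ε → 0ℚ < ε → 0ℚ < ½ * ε
  half-pos ε ε>0 = subst (_< ½ * ε) (ℚₚ.*-zeroʳ ½) (ℚₚ.*-monoʳ-<-pos ½ ε>0)

  half+half : ∀ ε → ½ * ε + ½ * ε ≡ ε
  half+half ε = trans (sym (ℚₚ.*-distribʳ-+ ε ½ ½)) (ℚₚ.*-identityˡ ε)

  interchange : ∀ a b c d → (a + b) - (c + d) ≡ (a - c) + (b - d)
  interchange = solve 4 (λ a b c d → (a :+ b) :- (c :+ d) := (a :- c) :+ (b :- d)) refl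
    where open +-*-Solver

  factor : ∀ q a b → q * a - q * b ≡ q * (a - b)
  factor = solve 3 (λ q a b → q :* a :- q :* b := q :* (a :- b)) refl
    where open +-*-Solver

infixl 6 _+ᵣ_
infixr 7 _·_

_+ᵣ_ : ℝ → ℝ → ℝ
seq (x +ᵣ y) n = seq x n + seq y n
cauchy (x +ᵣ y) ε ε>0 with cauchy x (½ * ε) (half-pos ε ε>0) | cauchy y (½ * ε) (half-pos ε ε>0)
... | M , p | N , q = M ℕ.⊔ N , λ m n m≥ n≥ → begin-strict
    ∣ (seq x m + seq y m) - (seq x n + seq y n) ∣
      ≡⟨ cong ∣_∣ (interchange (seq x m) (seq y m) (seq x n) (seq y n)) ⟩
    ∣ (seq x m - seq x n) + (seq y m - seq y n) ∣
      ≤⟨ ℚₚ.∣p+q∣≤∣p∣+∣q∣ (seq x m - seq x n) (seq y m - seq y n) ⟩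
    ∣ seq x m - seq x n ∣ + ∣ seq y m - seq y n ∣
      <⟨ ℚₚ.+-mono-< (p m n (ℕₚ.m⊔n≤o⇒m≤o M N m≥) (ℕₚ.m⊔n≤o⇒m≤o M N n≥))
                     (q m n (ℕₚ.m⊔n≤o⇒n≤o M N m≥) (ℕₚ.m⊔n≤o⇒n≤o M N n≥)) ⟩
    ½ * ε + ½ * ε
      ≡⟨ half+half ε ⟩
    ε ∎
  where open ℚₚ.≤-Reasoning

_·_ : ℚ → ℝ → ℝ
seq (q · x) n = q * seq x n
cauchy (q · x) ε ε>0 = let N , p = cauchy x δ δ>0 in N , λ m n m≥ n≥ → begin-strict
    ∣ q * seq x m - q * seq x n ∣  ≡⟨ cong ∣_∣ (factor q (seq x m) (seq x n)) ⟩
    ∣ q * (seq x m - seq x n) ∣    ≡⟨ ℚₚ.∣p*q∣≡∣p∣*∣q∣ q (seq x m - seq x n) ⟩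
    ∣ q ∣ * ∣ seq x m - seq x n ∣  ≤⟨ ℚₚ.*-monoʳ-≤-nonNeg ∣ seq x m - seq x n ∣
                                        {{nonNegative (ℚₚ.0≤∣p∣ (seq x m - seq x n))}} ∣q∣≤c ⟩
    c * ∣ seq x m - seq x n ∣      <⟨ ℚₚ.*-monoʳ-<-pos c (p m n m≥ n≥) ⟩
    c * δ                          ≡⟨ sym (ℚₚ.*-assoc c (1/ c) ε) ⟩
    (c * 1/ c) * ε                 ≡⟨ cong (_* ε) (ℚₚ.*-inverseʳ c) ⟩
    1ℚ * ε                         ≡⟨ ℚₚ.*-identityˡ ε ⟩
    ε ∎
  where
  open ℚₚ.≤-Reasoning
  c : ℚ
  c = 1ℚ + ∣ q ∣
  instance
    c-pos : Positive c
    c-pos = ℚₚ.pos+nonNeg⇒pos 1ℚ ∣ q ∣ {{nonNegative (ℚₚ.0≤∣p∣ q)}}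
    c-nonZero : NonZero c
    c-nonZero = ℚₚ.pos⇒nonZero c
  δ : ℚ
  δ = 1/ c * ε
  δ>0 : 0ℚ < δ
  δ>0 = subst (_< δ) (ℚₚ.*-zeroʳ (1/ c)) (ℚₚ.*-monoʳ-<-pos (1/ c) {{ℚₚ.1/pos⇒pos c}} ε>0)
  ∣q∣≤c : ∣ q ∣ ≤ c
  ∣q∣≤c = subst (_≤ c) (ℚₚ.+-identityˡ ∣ q ∣) (ℚₚ.+-monoˡ-≤ ∣ q ∣ (ℚₚ.nonNegative⁻¹ 1ℚ))

sumᵣ : ∀ {n} → (Fin n → ℝ) → ℝ
sumᵣ = F.foldr _+ᵣ_ 0ℝ

Point : ℕ → Set
Point d = Fin d → ℝ

PointSet : ℕ → Set₁
PointSet d = Pred (Point d) 0ℓ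

infix 4 _≋_

_≋_ : ∀ {d} → Point d → Point d → Set
x ≋ y = ∀ c → x c ≃ y c

ι : ∀ {d} → Vec ℤ d → Point d
ι v c = fromℚ (fromℤ (lookup v c))

｛𝟎｝ : ∀ {d} → PointSet d
｛𝟎｝ x = x ≋ λ _ → 0ℝ

infixl 6 _⊕_

_⊕_ : ∀ {d} → PointSet d → PointSet d → PointSet d
(A ⊕ B) x = ∃ λ a → ∃ λ b → A a × B b × x ≋ λ c → a c +ᵣ b c

dilate : ∀ {d} → ℕ → PointSet d → PointSet d
dilate n A x = ∃ λ a → A a × x ≋ λ c → fromℕ n · a c

minkowski : ∀ {d k} → Vec (PointSet d) k → Subset k → PointSet d
minkowski []       []            = ｛𝟎｝
minkowski (A ∷ As) (inside  ∷ J) = A ⊕ minkowski As J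
minkowski (A ∷ As) (outside ∷ J) = minkowski As J

-- ∣ A ∩ ℤᵈ ∣ ≡ n, witnessed by a duplicate-free enumeration.
LatticeCount : ∀ {d} → PointSet d → ℕ → Set
LatticeCount {d} A n =
  ∃ λ (xs : List (Vec ℤ d)) → Unique xs × (∀ v → v ∈ xs ⇔ A (ι v)) × length xs ≡ n

-- A polytope is given by a nonempty finite family of lattice points of
-- which it is the convex hull; repetitions and non-vertices are allowed.
record LatticePolytope (d : ℕ) : Set where
  field
    size-1    : ℕ
    generator : Fin (suc size-1) → Vec ℤ d

  combination : (Fin (suc size-1) → ℝ) → Point d
  combination w c = sumᵣ λ i → fromℤ (lookup (generator i) c) · w i

  convexHull : PointSet d
  convexHull x = ∃ λ w → (∀ i → 0ℝ ≤ᵣ w i) × sumᵣ w ≃ 1ℝ × x ≋ combination w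

  affineHull : PointSet d
  affineHull x = ∃ λ w → sumᵣ w ≃ 1ℝ × x ≋ combination w

open LatticePolytope public

-- The affine hull of the generators is that of the polytope.
FullDimensional : ∀ {d} → LatticePolytope d → Set
FullDimensional P = ∀ x → affineHull P x

-- The polynomial ring ℚ[n]: coefficient lists, constant term first.
-- Trailing zeros are permitted, so equality is _≈ₚ_.

Poly : Set
Poly = List ℚ

coeff : Poly → ℕ → ℚ
coeff []      _       = 0ℚ
coeff (a ∷ p) zero    = a
coeff (a ∷ p) (suc m) = coeff p m

infix 4 _≈ₚ_

_≈ₚ_ : Poly → Poly → Set
p ≈ₚ q = ∀ m → coeff p m ≡ coeff q m

eval : Poly → ℚ → ℚ
eval []      x = 0ℚ
eval (a ∷ p) x = a + x * eval p x

infixl 6 _+ₚ_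
infixr 7 _·ₚ_
infixl 7 _*ₚ_

_+ₚ_ : Poly → Poly → Poly
[]      +ₚ q       = q
(a ∷ p) +ₚ []      = a ∷ p
(a ∷ p) +ₚ (b ∷ q) = (a + b) ∷ (p +ₚ q)

_·ₚ_ : ℚ → Poly → Poly
a ·ₚ p = List.map (a *_) p

_*ₚ_ : Poly → Poly → Poly
[]      *ₚ q = []
(a ∷ p) *ₚ q = (a ·ₚ q) +ₚ (0ℚ ∷ (p *ₚ q))

const : ℚ → Poly
const a = a ∷ []

X : Poly
X = 0ℚ ∷ 1ℚ ∷ []

sumₚ : ∀ {m} → (Fin m → Poly) → Poly
sumₚ = F.foldr _+ₚ_ []

sumₚ-syntax : ∀ m → (Fin m → Poly) → Poly
sumₚ-syntax _ = sumₚ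

infixl 10 sumₚ-syntax
syntax sumₚ-syntax m (λ i → p) = ∑ₚ[ i < m ] p

-- p (p − 1) ⋯ (p − d + 1)
falling : Poly → ℕ → Poly
falling p zero    = const 1ℚ
falling p (suc d) = falling p d *ₚ (p +ₚ const (- fromℕ d))

binomₚ : Poly → ℕ → Poly
binomₚ p d = ((+ 1 / (d !)) {{d !≢0}}) ·ₚ falling p d

IsEhrhart : ∀ {d} → PointSet d → Poly → Set
IsEhrhart A E = ∀ n → ∃ λ c → LatticeCount (dilate n A) c × eval E (fromℕ n) ≡ fromℕ c

IsHStarVector : ∀ {d} → LatticePolytope d → (Fin (suc d) → ℚ) → Set
IsHStarVector {d} P h = ∃ λ E → IsEhrhart (convexHull P) E ×
  E ≈ₚ ∑ₚ[ j < suc d ] (h j ·ₚ binomₚ (X +ₚ const (fromℕ d - fromℕ (toℕ j))) d)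

sign : ℕ → ℚ
sign m = fromℤ (-1ℤ ℤ.^ m)

sumSubsets : ∀ {k} → (Subset k → ℚ) → ℚ
sumSubsets {zero}  f = f []
sumSubsets {suc k} f = sumSubsets (λ J → f (inside ∷ J)) + sumSubsets (λ J → f (outside ∷ J))

-- The graph of DMV: cardinalities are unique, so at most one q satisfies
-- this, and one does whenever all the lattice point sets are finite.
IsDMV : ∀ {d k} → Vec (PointSet d) k → ℚ → Set
IsDMV {k = k} As q = ∃ λ (count : Subset k → ℕ) →
  (∀ J → LatticeCount (minkowski As J) (count J)) ×
  q ≡ sumSubsets λ J → sign (k ∸ ∣ J ∣ₛ) * fromℕ (count J)

-- A polynomial is determined by its values at the natural numbers, so M is
-- unique up to _≈ₚ_; likewise for IsEhrhart.
IsMixedEhrhart : ∀ {d k} → Vec (PointSet d) k → Poly → Set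
IsMixedEhrhart As M = ∀ n → IsDMV (map (dilate n) As) (eval M (fromℕ n))

-- Binomial coefficient with integer lower index, zero when that is negative.
binom : ℕ → ℤ → ℕ
binom m (+ l)    = m C l
binom m -[1+ _ ] = 0

{-# OPTIONS --safe #-}

-- Convexity gives mP + nP = (m + n)P, so P_J = |J| P and
--   ME(n) = Σ_J (-1)^(k-|J|) E_P(|J| n) = Σ_i (-1)^(k-i) C(k,i) E_P(i n),
-- into which the h*-expansion of E_P is substituted; a polynomial is
-- determined by its values at the naturals.  At n = 1 the coefficient of
-- h*_j is the k-th finite difference of x ↦ C(x + d - j, d) at 0, which by
-- Pascal's rule is C(d - j, d - k).
module Submission where

open import Defs
open import Algebra.Bundles using (CommutativeRing)
import Algebra.Properties.Semiring.Sum as SemiringSum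
open import Data.Nat.Base as ℕ using (ℕ; zero; suc; _≤_; _∸_; _!)
open import Data.Nat.Combinatorics using (_C_; nCk+nC[k+1]≡[n+1]C[k+1]; k>n⇒nCk≡0)
import Data.Nat.Properties as ℕₚ
open import Data.Integer.Base as ℤ using (+_) renaming (_-_ to _-ℤ_)
import Data.Integer.Properties as ℤₚ
open import Data.Rational.Base
  using (ℚ; 0ℚ; 1ℚ; _+_; _*_; _-_; -_; _/_; 1/_; ∣_∣; fromℚᵘ;
         NonZero; Positive; NonNegative; ≢-nonZero; nonNegative)
  renaming (_<_ to _<ℚ_; _≤_ to _≤ℚ_)
import Data.Rational.Properties as ℚₚ
open import Data.Rational.Solver using (module +-*-Solver)
open import Data.Rational.Unnormalised.Base as ℚᵘ using (mkℚᵘ; *≡*)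
import Data.Rational.Unnormalised.Properties as ℚᵘₚ
open import Data.Fin.Base as Fin using (Fin; zero; suc; toℕ; inject₁)
import Data.Fin.Properties as Finₚ
open import Data.Fin.Subset using (Subset; inside; outside) renaming (∣_∣ to ∣_∣ₛ)
open import Data.Fin.Subset.Properties using (∣p∣≤n)
open import Data.List.Base using ([]; _∷_; length)
open import Data.List.Membership.Propositional.Properties.WithK using (unique∧set⇒bag)
open import Data.List.Relation.Binary.BagAndSetEquality using (∼bag⇒↭)
open import Data.List.Relation.Binary.Permutation.Propositional.Properties using (↭-length)
open import Data.Product.Base using (∃; _×_; _,_; proj₁; proj₂)
open import Data.Vec.Base using ([]; _∷_; lookup; replicate)
open import Data.Vec.Properties using (map-replicate)
open import Function.Base using (_∘_)
open import Function.Bundles using (_⇔_; mk⇔; Equivalence)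
open import Function.Properties.Equivalence using ()
  renaming (refl to ⇔-refl; sym to ⇔-sym; trans to ⇔-trans)
open import Relation.Binary.PropositionalEquality

open CommutativeRing ℚₚ.+-*-commutativeRing using (semiring)
open SemiringSum semiring using (*-distribˡ-sum; sum-cong-≗; sum-init-last; ∑-distrib-+)
open +-*-Solver using (solve; _:=_; _:+_; _:*_; _:-_; :-_; con)
open Equivalence using (to; from)

-- The ordered ℚ-vector space of reals

-- Coordinates are Cauchy sequences compared by `≃`, so `mP + nP` and `(m + n)P` cannot be shown
-- equal as predicates. They are shown to have the same members, and lattice counts, which depend
-- only on membership, are carried across. The weights of the convex combination involved are
-- `m/(m + n)` and `n/(m + n)`, so scaling reals by rationals is enough. Each `⇔` in the theorem
-- needs two facts about counts: a DMV value is unique because cardinalities are, and it exists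
-- because the Ehrhart hypothesis supplies an enumeration for every dilate. Both formulas come from
-- one expression, `alternating`. Grouping its subsets by size gives the first formula; removing one
-- element of the ground set at a time gives the second.

≡⇒≃ : ∀ {x y} → (∀ n → seq x n ≡ seq y n) → x ≃ y
≡⇒≃ {x} {y} x≗y ε ε>0 = 0 , λ n _ →
  subst (_<ℚ ε) (cong ∣_∣ (sym (trans (cong (_- seq y n) (x≗y n)) (ℚₚ.+-inverseʳ (seq y n))))) ε>0

≃-sym : ∀ {x y} → x ≃ y → y ≃ x
≃-sym {x} {y} x≃y ε ε>0 = let N , p = x≃y ε ε>0 in N , λ n n≥N →
  subst (_<ℚ ε) (trans (sym (ℚₚ.∣-p∣≡∣p∣ (seq x n - seq y n)))
    (cong ∣_∣ (solve 2 (λ x y → :- (x :- y) := y :- x) refl (seq x n) (seq y n)))) (p n n≥N)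

fraction-pos : ∀ c .{{c>0 : Positive c}} {ε} → 0ℚ <ℚ ε → 0ℚ <ℚ (1/ c) {{ℚₚ.pos⇒nonZero c}} * ε
fraction-pos c {ε} ε>0 = subst (_<ℚ 1/c * ε) (ℚₚ.*-zeroʳ 1/c) (ℚₚ.*-monoʳ-<-pos 1/c {{ℚₚ.1/pos⇒pos c}} ε>0)
  where 1/c = (1/ c) {{ℚₚ.pos⇒nonZero c}}

halve : ∀ {ε} → 0ℚ <ℚ ε → ∃ λ δ → 0ℚ <ℚ δ × δ + δ ≡ ε
halve {ε} ε>0 = 1/ c * ε , fraction-pos c ε>0 ,
  solve 1 (λ e → con (1/ c) :* e :+ con (1/ c) :* e := e) refl ε
  where c = + 2 / 1

-- `≃` unfolds to a statement about `seq` alone, so unification cannot recover the reals with their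
-- `cauchy` fields. This is why implicit arguments are written out wherever these lemmas are
-- applied.
≃-trans : ∀ {x y z} → x ≃ y → y ≃ z → x ≃ z
≃-trans {x} {y} {z} x≃y y≃z ε ε>0 =
  let δ , δ>0 , 2δ≡ε = halve ε>0
      M , p = x≃y δ δ>0
      N , q = y≃z δ δ>0
  in M ℕ.⊔ N , λ n n≥ → begin-strict
    ∣ seq x n - seq z n ∣
      ≡⟨ cong ∣_∣ (solve 3 (λ x y z → x :- z := (x :- y) :+ (y :- z)) refl (seq x n) (seq y n) (seq z n)) ⟩
    ∣ (seq x n - seq y n) + (seq y n - seq z n) ∣
      ≤⟨ ℚₚ.∣p+q∣≤∣p∣+∣q∣ (seq x n - seq y n) (seq y n - seq z n) ⟩
    ∣ seq x n - seq y n ∣ + ∣ seq y n - seq z n ∣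
      <⟨ ℚₚ.+-mono-< (p n (ℕₚ.m⊔n≤o⇒m≤o M N n≥)) (q n (ℕₚ.m⊔n≤o⇒n≤o M N n≥)) ⟩
    δ + δ
      ≡⟨ 2δ≡ε ⟩
    ε ∎
  where open ℚₚ.≤-Reasoning

+ᵣ-cong : ∀ {x y z w} → x ≃ y → z ≃ w → x +ᵣ z ≃ y +ᵣ w
+ᵣ-cong {x} {y} {z} {w} x≃y z≃w ε ε>0 =
  let δ , δ>0 , 2δ≡ε = halve ε>0
      M , p = x≃y δ δ>0
      N , q = z≃w δ δ>0
  in M ℕ.⊔ N , λ n n≥ → begin-strict
    ∣ (seq x n + seq z n) - (seq y n + seq w n) ∣
      ≡⟨ cong ∣_∣ (solve 4 (λ x y z w → (x :+ z) :- (y :+ w) := (x :- y) :+ (z :- w))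
          refl (seq x n) (seq y n) (seq z n) (seq w n)) ⟩
    ∣ (seq x n - seq y n) + (seq z n - seq w n) ∣
      ≤⟨ ℚₚ.∣p+q∣≤∣p∣+∣q∣ (seq x n - seq y n) (seq z n - seq w n) ⟩
    ∣ seq x n - seq y n ∣ + ∣ seq z n - seq w n ∣
      <⟨ ℚₚ.+-mono-< (p n (ℕₚ.m⊔n≤o⇒m≤o M N n≥)) (q n (ℕₚ.m⊔n≤o⇒n≤o M N n≥)) ⟩
    δ + δ
      ≡⟨ 2δ≡ε ⟩
    ε ∎
  where open ℚₚ.≤-Reasoning

-- Dividing `ε` by `1 + ∣ q ∣` rather than by `∣ q ∣` covers `q = 0`, and the extra summand `δ`
-- makes the bound strict.
shrink : ∀ q {ε} → 0ℚ <ℚ ε → ∃ λ δ → 0ℚ <ℚ δ × ∣ q ∣ * δ <ℚ ε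
shrink q {ε} ε>0 = δ , δ>0 , (begin-strict
    ∣ q ∣ * δ         ≡⟨ ℚₚ.+-identityˡ (∣ q ∣ * δ) ⟨
    0ℚ + ∣ q ∣ * δ    <⟨ ℚₚ.+-monoˡ-< (∣ q ∣ * δ) δ>0 ⟩
    δ + ∣ q ∣ * δ     ≡⟨ solve 2 (λ d q → d :+ q :* d := (con 1ℚ :+ q) :* d) refl δ ∣ q ∣ ⟩
    c * (1/ c * ε)    ≡⟨ ℚₚ.*-assoc c (1/ c) ε ⟨
    c * 1/ c * ε      ≡⟨ cong (_* ε) (ℚₚ.*-inverseʳ c) ⟩
    1ℚ * ε            ≡⟨ ℚₚ.*-identityˡ ε ⟩
    ε                 ∎)
  where
  open ℚₚ.≤-Reasoning
  c : ℚ
  c = 1ℚ + ∣ q ∣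
  instance
    c-pos : Positive c
    c-pos = ℚₚ.pos+nonNeg⇒pos 1ℚ ∣ q ∣ {{nonNegative (ℚₚ.0≤∣p∣ q)}}
    c-nonZero : NonZero c
    c-nonZero = ℚₚ.pos⇒nonZero c
  δ : ℚ
  δ = 1/ c * ε
  δ>0 : 0ℚ <ℚ δ
  δ>0 = fraction-pos c ε>0

·-congʳ : ∀ q {x y} → x ≃ y → q · x ≃ q · y
·-congʳ q {x} {y} x≃y ε ε>0 =
  let δ , δ>0 , qδ<ε = shrink q ε>0
      N , p = x≃y δ δ>0
  in N , λ n n≥ → begin-strict
    ∣ q * seq x n - q * seq y n ∣
      ≡⟨ cong ∣_∣ (solve 3 (λ q x y → q :* x :- q :* y := q :* (x :- y)) refl q (seq x n) (seq y n)) ⟩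
    ∣ q * (seq x n - seq y n) ∣
      ≡⟨ ℚₚ.∣p*q∣≡∣p∣*∣q∣ q (seq x n - seq y n) ⟩
    ∣ q ∣ * ∣ seq x n - seq y n ∣
      ≤⟨ ℚₚ.*-monoˡ-≤-nonNeg ∣ q ∣ {{nonNegative (ℚₚ.0≤∣p∣ q)}} (ℚₚ.<⇒≤ (p n n≥)) ⟩
    ∣ q ∣ * δ
      <⟨ qδ<ε ⟩
    ε ∎
  where open ℚₚ.≤-Reasoning

+ᵣ-nonNeg : ∀ {x y} → 0ℝ ≤ᵣ x → 0ℝ ≤ᵣ y → 0ℝ ≤ᵣ x +ᵣ y
+ᵣ-nonNeg {x} {y} 0≤x 0≤y ε ε>0 =
  let δ , δ>0 , 2δ≡ε = halve ε>0
      M , p = 0≤x δ δ>0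
      N , q = 0≤y δ δ>0
  in M ℕ.⊔ N , λ n n≥ → begin-strict
    0ℚ + 0ℚ
      <⟨ ℚₚ.+-mono-< (p n (ℕₚ.m⊔n≤o⇒m≤o M N n≥)) (q n (ℕₚ.m⊔n≤o⇒n≤o M N n≥)) ⟩
    (seq x n + δ) + (seq y n + δ)
      ≡⟨ solve 3 (λ x y d → (x :+ d) :+ (y :+ d) := (x :+ y) :+ (d :+ d)) refl (seq x n) (seq y n) δ ⟩
    (seq x n + seq y n) + (δ + δ)
      ≡⟨ cong (_+_ (seq x n + seq y n)) 2δ≡ε ⟩
    (seq x n + seq y n) + ε ∎
  where open ℚₚ.≤-Reasoning

·-nonNeg : ∀ q .{{_ : NonNegative q}} {x} → 0ℝ ≤ᵣ x → 0ℝ ≤ᵣ q · x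
·-nonNeg q {x} 0≤x ε ε>0 =
  let δ , δ>0 , ∣q∣δ<ε = shrink q ε>0
      N , p = 0≤x δ δ>0
  in N , λ n n≥ → begin-strict
    0ℚ
      ≡⟨ ℚₚ.*-zeroʳ q ⟨
    q * 0ℚ
      ≤⟨ ℚₚ.*-monoˡ-≤-nonNeg q (ℚₚ.<⇒≤ (p n n≥)) ⟩
    q * (seq x n + δ)
      ≡⟨ ℚₚ.*-distribˡ-+ q (seq x n) δ ⟩
    q * seq x n + q * δ
      ≡⟨ cong (λ r → q * seq x n + r * δ) (ℚₚ.0≤p⇒∣p∣≡p (ℚₚ.nonNegative⁻¹ q)) ⟨
    q * seq x n + ∣ q ∣ * δ
      <⟨ ℚₚ.+-monoʳ-< (q * seq x n) ∣q∣δ<ε ⟩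
    q * seq x n + ε ∎
  where open ℚₚ.≤-Reasoning

≤⇒≤ᵣ : ∀ {p q} → p ≤ℚ q → fromℚ p ≤ᵣ fromℚ q
≤⇒≤ᵣ {p} {q} p≤q ε ε>0 = 0 , λ _ _ →
  subst (_<ℚ q + ε) (ℚₚ.+-identityʳ p) (ℚₚ.+-mono-≤-< p≤q ε>0)

-- Stated for the `n`-th approximants, where linearity is an exact identity of rationals and no `ε`
-- occurs. It serves both the sum of the weights and the coordinates of a combination.
sumᵣ-linear : ∀ {m} α β (u v w : Fin m → ℝ) n →
  (∀ i → seq (u i) n ≡ α * seq (v i) n + β * seq (w i) n) →
  seq (sumᵣ u) n ≡ α * seq (sumᵣ v) n + β * seq (sumᵣ w) n
sumᵣ-linear {zero}  α β u v w n u≡ = solve 2 (λ α β → con 0ℚ := α :* con 0ℚ :+ β :* con 0ℚ) refl α β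
sumᵣ-linear {suc m} α β u v w n u≡ = trans
  (cong₂ _+_ (u≡ zero) (sumᵣ-linear α β (u ∘ suc) (v ∘ suc) (w ∘ suc) n (u≡ ∘ suc)))
  (solve 6 (λ α β a b s t → (α :* a :+ β :* b) :+ (α :* s :+ β :* t) := α :* (a :+ s) :+ β :* (b :+ t))
      refl
    α β (seq (v zero) n) (seq (w zero) n) (seq (sumᵣ (v ∘ suc)) n) (seq (sumᵣ (w ∘ suc)) n))

open ≡-Reasoning

-- Rational arithmetic

-- Normalisation by the gcd blocks computation on variables, so identities for `fromℤ` and `fromℕ`
-- are transported from unnormalised fractions.
fromℚᵘ-homo-+ : ∀ p q → fromℚᵘ (p ℚᵘ.+ q) ≡ fromℚᵘ p + fromℚᵘ q
fromℚᵘ-homo-+ p q = ℚₚ.toℚᵘ-injective (ℚᵘₚ.≃-trans (ℚₚ.toℚᵘ-fromℚᵘ (p ℚᵘ.+ q))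
  (ℚᵘₚ.≃-sym (ℚᵘₚ.≃-trans (ℚₚ.toℚᵘ-homo-+ (fromℚᵘ p) (fromℚᵘ q))
    (ℚᵘₚ.+-cong (ℚₚ.toℚᵘ-fromℚᵘ p) (ℚₚ.toℚᵘ-fromℚᵘ q)))))

fromℚᵘ-homo-* : ∀ p q → fromℚᵘ (p ℚᵘ.* q) ≡ fromℚᵘ p * fromℚᵘ q
fromℚᵘ-homo-* p q = ℚₚ.toℚᵘ-injective (ℚᵘₚ.≃-trans (ℚₚ.toℚᵘ-fromℚᵘ (p ℚᵘ.* q))
  (ℚᵘₚ.≃-sym (ℚᵘₚ.≃-trans (ℚₚ.toℚᵘ-homo-* (fromℚᵘ p) (fromℚᵘ q))
    (ℚᵘₚ.*-cong (ℚₚ.toℚᵘ-fromℚᵘ p) (ℚₚ.toℚᵘ-fromℚᵘ q)))))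

fromℤ-homo-+ : ∀ a b → fromℤ (a ℤ.+ b) ≡ fromℤ a + fromℤ b
fromℤ-homo-+ a b = trans
  (cong fromℤ (cong₂ ℤ._+_ (sym (ℤₚ.*-identityʳ a)) (sym (ℤₚ.*-identityʳ b))))
  (fromℚᵘ-homo-+ (mkℚᵘ a 0) (mkℚᵘ b 0))

fromℤ-homo-* : ∀ a b → fromℤ (a ℤ.* b) ≡ fromℤ a * fromℤ b
fromℤ-homo-* a b = fromℚᵘ-homo-* (mkℚᵘ a 0) (mkℚᵘ b 0)

fromℕ-homo-+ : ∀ m n → fromℕ (m ℕ.+ n) ≡ fromℕ m + fromℕ n
fromℕ-homo-+ m n = fromℤ-homo-+ (+ m) (+ n)

fromℕ-homo-* : ∀ m n → fromℕ (m ℕ.* n) ≡ fromℕ m * fromℕ n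
fromℕ-homo-* m n = trans (cong fromℤ (ℤₚ.pos-* m n)) (fromℤ-homo-* (+ m) (+ n))

fromℕ-homo-∸ : ∀ {m n} → n ≤ m → fromℕ (m ∸ n) ≡ fromℕ m - fromℕ n
fromℕ-homo-∸ {m} {n} n≤m = begin
  fromℕ (m ∸ n)                        ≡⟨ solve 2 (λ x y → x := (x :+ y) :- y) refl _ (fromℕ n) ⟩
  fromℕ (m ∸ n) + fromℕ n - fromℕ n    ≡⟨ cong (_- fromℕ n) (fromℕ-homo-+ (m ∸ n) n) ⟨
  fromℕ (m ∸ n ℕ.+ n) - fromℕ n        ≡⟨ cong (λ l → fromℕ l - fromℕ n) (ℕₚ.m∸n+n≡m n≤m) ⟩
  fromℕ m - fromℕ n                    ∎

fromℕ-*-inverse : ∀ n .{{_ : ℕ.NonZero n}} → fromℕ n * (+ 1 / n) ≡ 1ℚ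
fromℕ-*-inverse n@(suc m) = trans (sym (fromℚᵘ-homo-* (mkℚᵘ (+ n) 0) (mkℚᵘ (+ 1) m)))
  (ℚₚ.fromℚᵘ-cong {mkℚᵘ (+ n) 0 ℚᵘ.* mkℚᵘ (+ 1) m} {ℚᵘ.1ℚᵘ} (*≡* (cong +_ (begin
    suc (m ℕ.* 1 ℕ.* 1)     ≡⟨ cong suc (trans (ℕₚ.*-identityʳ (m ℕ.* 1)) (ℕₚ.*-identityʳ m)) ⟩
    suc m                   ≡⟨ cong suc (ℕₚ.+-identityʳ m) ⟨
    suc (m ℕ.+ 0)           ≡⟨ cong suc (ℕₚ.+-identityʳ (m ℕ.+ 0)) ⟨
    suc (m ℕ.+ 0 ℕ.+ 0)     ∎))))

sign-suc : ∀ m → sign (suc m) ≡ - sign m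
sign-suc m = trans (fromℤ-homo-* ℤ.-1ℤ (ℤ.-1ℤ ℤ.^ m))
  (solve 1 (λ x → con (fromℤ ℤ.-1ℤ) :* x := :- x) refl (sign m))

-- Evaluation of polynomials

eval-const : ∀ a x → eval (const a) x ≡ a
eval-const = solve 2 (λ a x → a :+ x :* con 0ℚ := a) refl

eval-X : ∀ x → eval X x ≡ x
eval-X = solve 1 (λ x → con 0ℚ :+ x :* (con 1ℚ :+ x :* con 0ℚ) := x) refl

eval-+ₚ : ∀ p q x → eval (p +ₚ q) x ≡ eval p x + eval q x
eval-+ₚ []      q       x = sym (ℚₚ.+-identityˡ _)
eval-+ₚ (a ∷ p) []      x = sym (ℚₚ.+-identityʳ _)
eval-+ₚ (a ∷ p) (b ∷ q) x = trans (cong (λ s → a + b + x * s) (eval-+ₚ p q x))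
  (solve 5 (λ a b x s t → a :+ b :+ x :* (s :+ t) := (a :+ x :* s) :+ (b :+ x :* t)) refl
    a b x (eval p x) (eval q x))

eval-·ₚ : ∀ a p x → eval (a ·ₚ p) x ≡ a * eval p x
eval-·ₚ a []      x = sym (ℚₚ.*-zeroʳ a)
eval-·ₚ a (b ∷ p) x = trans (cong (λ s → a * b + x * s) (eval-·ₚ a p x))
  (solve 4 (λ a b x s → a :* b :+ x :* (a :* s) := a :* (b :+ x :* s)) refl a b x (eval p x))

eval-*ₚ : ∀ p q x → eval (p *ₚ q) x ≡ eval p x * eval q x
eval-*ₚ []      q x = sym (ℚₚ.*-zeroˡ (eval q x))
eval-*ₚ (a ∷ p) q x = begin
  eval ((a ·ₚ q) +ₚ (0ℚ ∷ (p *ₚ q))) x           ≡⟨ eval-+ₚ (a ·ₚ q) (0ℚ ∷ (p *ₚ q)) x ⟩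
  eval (a ·ₚ q) x + (0ℚ + x * eval (p *ₚ q) x)
    ≡⟨ cong₂ (λ s t → s + (0ℚ + x * t)) (eval-·ₚ a q x) (eval-*ₚ p q x) ⟩
  a * eval q x + (0ℚ + x * (eval p x * eval q x))
    ≡⟨ solve 4 (λ a x s t → a :* t :+ (con 0ℚ :+ x :* (s :* t)) := (a :+ x :* s) :* t)
        refl a x (eval p x) (eval q x) ⟩
  (a + x * eval p x) * eval q x                  ∎

eval-sumₚ : ∀ {m} (f : Fin m → Poly) x → eval (sumₚ f) x ≡ ∑[ i < m ] eval (f i) x
eval-sumₚ {zero}  f x = refl
eval-sumₚ {suc m} f x = trans (eval-+ₚ (f zero) (sumₚ (f ∘ suc)) x)
  (cong (_+_ (eval (f zero) x)) (eval-sumₚ (f ∘ suc) x))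

eval-zero : ∀ p → (∀ m → coeff p m ≡ 0ℚ) → ∀ x → eval p x ≡ 0ℚ
eval-zero []      p≈0 x = refl
eval-zero (a ∷ p) p≈0 x = trans (cong₂ (λ s t → s + x * t) (p≈0 0) (eval-zero p (p≈0 ∘ suc) x))
  (trans (ℚₚ.+-identityˡ _) (ℚₚ.*-zeroʳ x))

eval-resp-≈ₚ : ∀ p q → p ≈ₚ q → ∀ x → eval p x ≡ eval q x
eval-resp-≈ₚ []      q       p≈q x = sym (eval-zero q (sym ∘ p≈q) x)
eval-resp-≈ₚ (a ∷ p) []      p≈q x = eval-zero (a ∷ p) p≈q x
eval-resp-≈ₚ (a ∷ p) (b ∷ q) p≈q x =
  cong₂ (λ s t → s + x * t) (p≈q 0) (eval-resp-≈ₚ p q (p≈q ∘ suc) x)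

fallingℚ : ℚ → ℕ → ℚ
fallingℚ x zero    = 1ℚ
fallingℚ x (suc d) = fallingℚ x d * (x - fromℕ d)

binomℚ : ℚ → ℕ → ℚ
binomℚ x d = ((+ 1 / (d !)) {{d ℕₚ.!≢0}}) * fallingℚ x d

eval-falling : ∀ p d x → eval (falling p d) x ≡ fallingℚ (eval p x) d
eval-falling p zero    x = eval-const 1ℚ x
eval-falling p (suc d) x = trans (eval-*ₚ (falling p d) (p +ₚ const (- fromℕ d)) x)
  (cong₂ _*_ (eval-falling p d x)
    (trans (eval-+ₚ p (const (- fromℕ d)) x) (cong (_+_ (eval p x)) (eval-const (- fromℕ d) x))))

eval-binomₚ : ∀ p d x → eval (binomₚ p d) x ≡ binomℚ (eval p x) d
eval-binomₚ p d x = trans (eval-·ₚ c (falling p d) x) (cong (c *_) (eval-falling p d x))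
  where
  c : ℚ
  c = (+ 1 / (d !)) {{d ℕₚ.!≢0}}

-- A polynomial vanishing at all large naturals is zero

-- Synthetic division of a ∷ p by X − r; the quotient does not depend on a.
quotient : ℚ → Poly → Poly
quotient r []      = []
quotient r (b ∷ p) = eval (b ∷ p) r ∷ quotient r p

-- The remainder theorem. The coefficients of the quotient are the intermediate values of Horner's
-- scheme at `r`, which is why `quotient` is built from values of tails.
eval-quotient : ∀ r a p x →
  eval (a ∷ p) x ≡ (x - r) * eval (quotient r p) x + eval (a ∷ p) r
eval-quotient r a []      x =
  solve 3 (λ r a x → a :+ x :* con 0ℚ := (x :- r) :* con 0ℚ :+ (a :+ r :* con 0ℚ)) refl r a x
eval-quotient r a (b ∷ p) x = trans (cong (λ s → a + x * s) (eval-quotient r b p x))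
  (solve 5 (λ r a x s t → a :+ x :* ((x :- r) :* s :+ t) := (x :- r) :* (t :+ x :* s) :+ (a :+ r :* t))
    refl r a x (eval (quotient r p) x) (eval (b ∷ p) r))

-- The constant coefficient of the quotient is the value of the tail at `r`. Its vanishing forces
-- `a` to vanish and is also the remainder hypothesis needed for the tail.
quotient-zero : ∀ r a p → eval (a ∷ p) r ≡ 0ℚ → (∀ m → coeff (quotient r p) m ≡ 0ℚ) →
  ∀ m → coeff (a ∷ p) m ≡ 0ℚ
quotient-zero r a []      e z zero    = trans (solve 2 (λ r a → a := a :+ r :* con 0ℚ) refl r a) e
quotient-zero r a []      e z (suc m) = refl
quotient-zero r a (b ∷ p) e z zero    = begin
  a                           ≡⟨ solve 2 (λ r a → a := a :+ r :* con 0ℚ) refl r a ⟩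
  a + r * 0ℚ                  ≡⟨ cong (λ s → a + r * s) (z 0) ⟨
  a + r * eval (b ∷ p) r      ≡⟨ e ⟩
  0ℚ                          ∎
quotient-zero r a (b ∷ p) e z (suc m) = quotient-zero r b p (z 0) (z ∘ suc) m

length-quotient : ∀ r p → length (quotient r p) ≡ length p
length-quotient r []      = refl
length-quotient r (b ∷ p) = cong suc (length-quotient r p)

fromℕ≢0 : ∀ n .{{_ : ℕ.NonZero n}} → fromℕ n ≢ 0ℚ
fromℕ≢0 n n≡0 with () ← trans (sym (fromℕ-*-inverse n))
                          (trans (cong (_* (+ 1 / n)) n≡0) (ℚₚ.*-zeroˡ (+ 1 / n)))

*-cancel-0 : ∀ {p q} → p ≢ 0ℚ → p * q ≡ 0ℚ → q ≡ 0ℚ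
*-cancel-0 {p} {q} p≢0 pq≡0 = begin
  q                ≡⟨ ℚₚ.*-identityˡ q ⟨
  1ℚ * q           ≡⟨ cong (_* q) (ℚₚ.*-inverseˡ p) ⟨
  1/ p * p * q     ≡⟨ ℚₚ.*-assoc (1/ p) p q ⟩
  1/ p * (p * q)   ≡⟨ cong (1/ p *_) pq≡0 ⟩
  1/ p * 0ℚ        ≡⟨ ℚₚ.*-zeroʳ (1/ p) ⟩
  0ℚ               ∎
  where instance p-nonZero = ≢-nonZero p≢0

-- Divide by `X − N` and recurse. The quotient is not a subterm of the list, so its length `l`
-- drives the recursion; the bound rises to `suc N` because the factor `n − N` can be cancelled only
-- for `n > N`.
zero-polynomial : ∀ l p N → length p ≡ l → (∀ n → N ≤ n → eval p (fromℕ n) ≡ 0ℚ) →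
  ∀ m → coeff p m ≡ 0ℚ
zero-polynomial l       []      N _  _ m = refl
zero-polynomial (suc l) (a ∷ p) N eq v = quotient-zero r a p (v N ℕₚ.≤-refl)
  (zero-polynomial l (quotient r p) (suc N) (trans (length-quotient r p) (ℕₚ.suc-injective eq)) vanishes)
  where
  r = fromℕ N
  vanishes : ∀ n → N ℕ.< n → eval (quotient r p) (fromℕ n) ≡ 0ℚ
  vanishes n N<n = *-cancel-0 n-r≢0 (begin
    (fromℕ n - r) * s        ≡⟨ ℚₚ.+-identityʳ _ ⟨
    (fromℕ n - r) * s + 0ℚ   ≡⟨ cong (_+_ ((fromℕ n - r) * s)) (v N ℕₚ.≤-refl) ⟨
    (fromℕ n - r) * s + eval (a ∷ p) r ≡⟨ eval-quotient r a p (fromℕ n) ⟨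
    eval (a ∷ p) (fromℕ n)   ≡⟨ v n (ℕₚ.<⇒≤ N<n) ⟩
    0ℚ                       ∎)
    where
    s = eval (quotient r p) (fromℕ n)
    n-r≢0 : fromℕ n - r ≢ 0ℚ
    n-r≢0 e = fromℕ≢0 (n ∸ N) {{ℕ.>-nonZero (ℕₚ.m<n⇒0<n∸m N<n)}}
      (trans (fromℕ-homo-∸ (ℕₚ.<⇒≤ N<n)) e)

coeff-+ₚ : ∀ p q m → coeff (p +ₚ q) m ≡ coeff p m + coeff q m
coeff-+ₚ []      q       m       = sym (ℚₚ.+-identityˡ _)
coeff-+ₚ (a ∷ p) []      m       = sym (ℚₚ.+-identityʳ _)
coeff-+ₚ (a ∷ p) (b ∷ q) zero    = refl
coeff-+ₚ (a ∷ p) (b ∷ q) (suc m) = coeff-+ₚ p q m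

coeff-·ₚ : ∀ a p m → coeff (a ·ₚ p) m ≡ a * coeff p m
coeff-·ₚ a []      m       = sym (ℚₚ.*-zeroʳ a)
coeff-·ₚ a (b ∷ p) zero    = refl
coeff-·ₚ a (b ∷ p) (suc m) = coeff-·ₚ a p m

x+[-1]y≡0⇒x≡y : ∀ x y → x + - 1ℚ * y ≡ 0ℚ → x ≡ y
x+[-1]y≡0⇒x≡y x y e = begin
  x                     ≡⟨ solve 2 (λ x y → x := (x :+ con (- 1ℚ) :* y) :+ y) refl x y ⟩
  (x + - 1ℚ * y) + y    ≡⟨ cong (_+ y) e ⟩
  0ℚ + y                ≡⟨ ℚₚ.+-identityˡ y ⟩
  y                     ∎

polynomial-identity : ∀ p q → (∀ n → eval p (fromℕ n) ≡ eval q (fromℕ n)) → p ≈ₚ q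
polynomial-identity p q p≗q m = x+[-1]y≡0⇒x≡y _ _ (begin
  coeff p m + - 1ℚ * coeff q m      ≡⟨ cong (_+_ (coeff p m)) (coeff-·ₚ (- 1ℚ) q m) ⟨
  coeff p m + coeff (- 1ℚ ·ₚ q) m   ≡⟨ coeff-+ₚ p (- 1ℚ ·ₚ q) m ⟨
  coeff (p +ₚ - 1ℚ ·ₚ q) m
    ≡⟨ zero-polynomial _ (p +ₚ - 1ℚ ·ₚ q) 0 refl (λ n _ → vanishes (fromℕ n) (p≗q n)) m ⟩
  0ℚ                                ∎)
  where
  vanishes : ∀ x → eval p x ≡ eval q x → eval (p +ₚ - 1ℚ ·ₚ q) x ≡ 0ℚ
  vanishes x e = begin
    eval (p +ₚ - 1ℚ ·ₚ q) x           ≡⟨ eval-+ₚ p (- 1ℚ ·ₚ q) x ⟩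
    eval p x + eval (- 1ℚ ·ₚ q) x     ≡⟨ cong₂ _+_ e (eval-·ₚ (- 1ℚ) q x) ⟩
    eval q x + - 1ℚ * eval q x        ≡⟨ solve 1 (λ y → y :+ con (- 1ℚ) :* y := con 0ℚ) refl (eval q x) ⟩
    0ℚ                                ∎

-- Binomial coefficients and finite differences

fromℕ-suc : ∀ n → fromℕ (suc n) ≡ 1ℚ + fromℕ n
fromℕ-suc = fromℕ-homo-+ 1

-- The definition splits off the last factor of the product, this the first. In every other factor
-- the shifts of `x` and of the index cancel.
fallingℚ-suc : ∀ x d → fallingℚ (1ℚ + x) (suc d) ≡ (1ℚ + x) * fallingℚ x d
fallingℚ-suc x zero    = solve 1 (λ x → con 1ℚ :* (con 1ℚ :+ x :- con 0ℚ) := (con 1ℚ :+ x) :* con 1ℚ)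
    refl x
fallingℚ-suc x (suc d) = trans
  (cong₂ (λ s t → s * (1ℚ + x - t)) (fallingℚ-suc x d) (fromℕ-suc d))
  (solve 3 (λ x s t → (con 1ℚ :+ x) :* s :* (con 1ℚ :+ x :- (con 1ℚ :+ t))
      := (con 1ℚ :+ x) :* (s :* (x :- t)))
    refl x (fallingℚ x d) (fromℕ d))

1/!-suc : ∀ d → (+ 1 / (d !)) {{d ℕₚ.!≢0}} ≡ fromℕ (suc d) * (+ 1 / (suc d !)) {{suc d ℕₚ.!≢0}}
1/!-suc d = begin
  c                                    ≡⟨ ℚₚ.*-identityʳ c ⟨
  c * 1ℚ                               ≡⟨ cong (c *_) (fromℕ-*-inverse (suc d !)) ⟨
  c * (fromℕ (suc d !) * c′)           ≡⟨ cong (λ s → c * (s * c′)) (fromℕ-homo-* (suc d) (d !)) ⟩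
  c * (fromℕ (suc d) * fromℕ (d !) * c′)
    ≡⟨ solve 4 (λ c s f c′ → c :* (s :* f :* c′) := (f :* c) :* (s :* c′))
        refl c (fromℕ (suc d)) (fromℕ (d !)) c′ ⟩
  (fromℕ (d !) * c) * (fromℕ (suc d) * c′) ≡⟨ cong (_* (fromℕ (suc d) * c′)) (fromℕ-*-inverse (d !)) ⟩
  1ℚ * (fromℕ (suc d) * c′)            ≡⟨ ℚₚ.*-identityˡ _ ⟩
  fromℕ (suc d) * c′                   ∎
  where
  instance
    d!-nonZero = d ℕₚ.!≢0
    sd!-nonZero = suc d ℕₚ.!≢0
  c c′ : ℚ
  c  = + 1 / (d !)
  c′ = + 1 / (suc d !)

binomℚ-pascal : ∀ x d → binomℚ (1ℚ + x) (suc d) ≡ binomℚ x d + binomℚ x (suc d)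
binomℚ-pascal x d = begin
  c′ * fallingℚ (1ℚ + x) (suc d)      ≡⟨ cong (c′ *_) (fallingℚ-suc x d) ⟩
  c′ * ((1ℚ + x) * F)
    -- Splits the factor as `1 + x = (1 + d) + (x − d)`: the first part cancels against `(d + 1)!`,
    -- the second extends the falling factorial.
    ≡⟨ solve 4 (λ c x F d → c :* ((con 1ℚ :+ x) :* F) := (con 1ℚ :+ d) :* c :* F :+ c :* (F :* (x :- d)))
        refl c′ x F (fromℕ d) ⟩
  (1ℚ + fromℕ d) * c′ * F + c′ * (F * (x - fromℕ d))
    ≡⟨ cong (λ s → s * c′ * F + binomℚ x (suc d)) (fromℕ-suc d) ⟨
  fromℕ (suc d) * c′ * F + binomℚ x (suc d)
    ≡⟨ cong (λ s → s * F + binomℚ x (suc d)) (1/!-suc d) ⟨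
  binomℚ x d + binomℚ x (suc d) ∎
  where
  c′ F : ℚ
  c′ = (+ 1 / (suc d !)) {{suc d ℕₚ.!≢0}}
  F = fallingℚ x d

binomℚ-0 : ∀ d → binomℚ 0ℚ (suc d) ≡ 0ℚ
binomℚ-0 d = trans (cong (c *_) (fallingℚ-0 d)) (ℚₚ.*-zeroʳ c)
  where
  c = (+ 1 / (suc d !)) {{suc d ℕₚ.!≢0}}
  fallingℚ-0 : ∀ d → fallingℚ 0ℚ (suc d) ≡ 0ℚ
  fallingℚ-0 zero    = refl
  fallingℚ-0 (suc d) = trans (cong (_* (0ℚ - fromℕ (suc d))) (fallingℚ-0 d)) (ℚₚ.*-zeroˡ (0ℚ - fromℕ (suc d)))

-- Both sides obey Pascal's rule with the same boundary values. This also covers `m < d`, where both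
-- vanish.
binomℚ-fromℕ : ∀ m d → binomℚ (fromℕ m) d ≡ fromℕ (m C d)
binomℚ-fromℕ m       zero    = refl
binomℚ-fromℕ zero    (suc d) = binomℚ-0 d
binomℚ-fromℕ (suc m) (suc d) = begin
  binomℚ (fromℕ (suc m)) (suc d)                    ≡⟨ cong (λ x → binomℚ x (suc d)) (fromℕ-suc m) ⟩
  binomℚ (1ℚ + fromℕ m) (suc d)                     ≡⟨ binomℚ-pascal (fromℕ m) d ⟩
  binomℚ (fromℕ m) d + binomℚ (fromℕ m) (suc d)     ≡⟨ cong₂ _+_ (binomℚ-fromℕ m d) (binomℚ-fromℕ m (suc d)) ⟩
  fromℕ (m C d) + fromℕ (m C suc d)                 ≡⟨ fromℕ-homo-+ (m C d) (m C suc d) ⟨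
  fromℕ (m C d ℕ.+ m C suc d)                       ≡⟨ cong fromℕ (nCk+nC[k+1]≡[n+1]C[k+1] m d) ⟩
  fromℕ (suc m C suc d)                             ∎

-- Sums over subsets and iterated differences

sumSubsets-cong : ∀ {k} {f g : Subset k → ℚ} → (∀ J → f J ≡ g J) → sumSubsets f ≡ sumSubsets g
sumSubsets-cong {zero}  f≗g = f≗g []
sumSubsets-cong {suc k} f≗g =
  cong₂ _+_ (sumSubsets-cong (f≗g ∘ (inside ∷_))) (sumSubsets-cong (f≗g ∘ (outside ∷_)))

sumSubsets-+ : ∀ {k} (f g : Subset k → ℚ) →
  sumSubsets f + sumSubsets g ≡ sumSubsets (λ J → f J + g J)
sumSubsets-+ {zero}  f g = refl
sumSubsets-+ {suc k} f g = trans
  (solve 4 (λ a b c d → (a :+ b) :+ (c :+ d) := (a :+ c) :+ (b :+ d)) refl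
    (sumSubsets (f ∘ (inside ∷_))) (sumSubsets (f ∘ (outside ∷_)))
    (sumSubsets (g ∘ (inside ∷_))) (sumSubsets (g ∘ (outside ∷_))))
  (cong₂ _+_ (sumSubsets-+ (f ∘ (inside ∷_)) (g ∘ (inside ∷_)))
             (sumSubsets-+ (f ∘ (outside ∷_)) (g ∘ (outside ∷_))))

sumSubsets-by-size : ∀ k (F : ℕ → ℚ) →
  sumSubsets {k} (λ J → F ∣ J ∣ₛ) ≡ ∑[ i < suc k ] (fromℕ (k C toℕ i) * F (toℕ i))
sumSubsets-by-size zero    F = solve 1 (λ x → x := con 1ℚ :* x :+ con 0ℚ) refl (F 0)
sumSubsets-by-size (suc k) F = begin
  sumSubsets {k} (λ J → F (suc ∣ J ∣ₛ)) + sumSubsets {k} (λ J → F ∣ J ∣ₛ)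
    -- `extend` appends the term of index `k + 1`, which is zero because `k C suc k` is. The second
    -- sum then splits into its term at 0 and the shifted sum `upper`, which has the range of
    -- `lower`.
    ≡⟨ cong₂ _+_ (sumSubsets-by-size k (F ∘ suc)) (trans (sumSubsets-by-size k F) extend) ⟩
  ∑[ i < suc k ] lower i + (fromℕ 1 * F 0 + ∑[ i < suc k ] upper i)
    ≡⟨ solve 3 (λ a b c → a :+ (b :+ c) := b :+ (a :+ c)) refl (sum lower) (fromℕ 1 * F 0) (sum upper) ⟩
  fromℕ 1 * F 0 + (∑[ i < suc k ] lower i + ∑[ i < suc k ] upper i)
    ≡⟨ cong (_+_ (fromℕ 1 * F 0)) (∑-distrib-+ lower upper) ⟨
  fromℕ 1 * F 0 + ∑[ i < suc k ] (lower i + upper i)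
    ≡⟨ cong (_+_ (fromℕ 1 * F 0)) (sum-cong-≗ {suc k} (pascal ∘ toℕ)) ⟩
  fromℕ 1 * F 0 + ∑[ i < suc k ] (fromℕ (suc k C suc (toℕ i)) * F (suc (toℕ i))) ∎
  where
  lower upper : Fin (suc k) → ℚ
  lower i = fromℕ (k C toℕ i) * F (suc (toℕ i))
  upper i = fromℕ (k C suc (toℕ i)) * F (suc (toℕ i))
  t : Fin (suc (suc k)) → ℚ
  t i = fromℕ (k C toℕ i) * F (toℕ i)
  extend : ∑[ i < suc k ] (fromℕ (k C toℕ i) * F (toℕ i)) ≡ ∑[ i < suc (suc k) ] t i
  extend = sym (begin
    sum t
      ≡⟨ sum-init-last t ⟩
    ∑[ i < suc k ] t (inject₁ i) + t (Fin.fromℕ (suc k))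
      ≡⟨ cong₂ _+_ (sum-cong-≗ {suc k} (λ i → cong (λ l → fromℕ (k C l) * F l) (Finₚ.toℕ-inject₁ i)))
                   (trans (cong (λ l → fromℕ (k C l) * F l) (Finₚ.toℕ-fromℕ (suc k)))
                     (trans (cong (λ c → fromℕ c * F (suc k)) (k>n⇒nCk≡0 (ℕₚ.n<1+n k)))
                         (ℚₚ.*-zeroˡ (F (suc k))))) ⟩
    ∑[ i < suc k ] (fromℕ (k C toℕ i) * F (toℕ i)) + 0ℚ
      ≡⟨ ℚₚ.+-identityʳ _ ⟩
    ∑[ i < suc k ] (fromℕ (k C toℕ i) * F (toℕ i)) ∎)
  pascal : ∀ i → fromℕ (k C i) * F (suc i) + fromℕ (k C suc i) * F (suc i) ≡ fromℕ (suc k C suc i) * F (suc i)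
  pascal i = begin
    fromℕ (k C i) * F (suc i) + fromℕ (k C suc i) * F (suc i)
      ≡⟨ ℚₚ.*-distribʳ-+ (F (suc i)) (fromℕ (k C i)) (fromℕ (k C suc i)) ⟨
    (fromℕ (k C i) + fromℕ (k C suc i)) * F (suc i)
      ≡⟨ cong (_* F (suc i)) (fromℕ-homo-+ (k C i) (k C suc i)) ⟨
    fromℕ (k C i ℕ.+ k C suc i) * F (suc i)
      ≡⟨ cong (λ c → fromℕ c * F (suc i)) (nCk+nC[k+1]≡[n+1]C[k+1] k i) ⟩
    fromℕ (suc k C suc i) * F (suc i) ∎

-- The `k`-th forward difference of `g` at 0, written over subsets so that it has the shape of the
-- sum in `IsDMV`.
alternating : ℕ → (ℕ → ℚ) → ℚ
alternating k g = sumSubsets {k} λ J → sign (k ∸ ∣ J ∣ₛ) * g ∣ J ∣ₛ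

alternating-cong : ∀ k {f g : ℕ → ℚ} → (∀ i → f i ≡ g i) → alternating k f ≡ alternating k g
alternating-cong k f≗g = sumSubsets-cong {k} (λ J → cong (sign (k ∸ ∣ J ∣ₛ) *_) (f≗g ∣ J ∣ₛ))

-- Pairs each subset omitting the first element with the one obtained by adding it; their signs are
-- opposite.
alternating-suc : ∀ k g → alternating (suc k) g ≡ alternating k (λ i → g (suc i) - g i)
alternating-suc k g = trans
  (sumSubsets-+ {k} (λ J → sign (k ∸ ∣ J ∣ₛ) * g (suc ∣ J ∣ₛ)) (λ J → sign (suc k ∸ ∣ J ∣ₛ) * g ∣ J ∣ₛ))
  (sumSubsets-cong {k} λ J → begin
    sign (k ∸ ∣ J ∣ₛ) * g (suc ∣ J ∣ₛ) + sign (suc k ∸ ∣ J ∣ₛ) * g ∣ J ∣ₛ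
      -- Subtraction is truncated, so pulling out the successor relies on `∣ J ∣ₛ ≤ k`.
      ≡⟨ cong (λ s → sign (k ∸ ∣ J ∣ₛ) * g (suc ∣ J ∣ₛ) + s * g ∣ J ∣ₛ)
              (trans (cong sign (ℕₚ.+-∸-assoc 1 (∣p∣≤n J))) (sign-suc (k ∸ ∣ J ∣ₛ))) ⟩
    sign (k ∸ ∣ J ∣ₛ) * g (suc ∣ J ∣ₛ) + - sign (k ∸ ∣ J ∣ₛ) * g ∣ J ∣ₛ
      ≡⟨ solve 3 (λ s a b → s :* a :+ (:- s) :* b := s :* (a :- b)) refl
           (sign (k ∸ ∣ J ∣ₛ)) (g (suc ∣ J ∣ₛ)) (g ∣ J ∣ₛ) ⟩
    sign (k ∸ ∣ J ∣ₛ) * (g (suc ∣ J ∣ₛ) - g ∣ J ∣ₛ) ∎)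

alternating-0 : ∀ k → alternating k (λ _ → 0ℚ) ≡ 0ℚ
alternating-0 zero    = refl
alternating-0 (suc k) = trans (alternating-suc k (λ _ → 0ℚ)) (alternating-0 k)

-- Each difference lowers `d` and `k` together and so preserves `d − k`. The offset `a` is
-- independent of `d` because it must stay fixed in this induction; it is later taken to be `d ∸ j`.
alternating-binom : ∀ k d a → alternating k (λ i → fromℕ ((i ℕ.+ a) C d)) ≡ fromℕ (binom a (+ d -ℤ + k))
alternating-binom zero d a = trans (ℚₚ.*-identityˡ (fromℕ (a C d)))
  (cong (λ l → fromℕ (a C l)) (sym (ℕₚ.+-identityʳ d)))
-- Here `k` outlasts `d`: the function has become the constant 1, whose difference is 0, and the
-- lower index of `binom` is negative.
alternating-binom (suc k) zero a = trans (alternating-suc k (λ _ → 1ℚ)) (alternating-0 k)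
alternating-binom (suc k) (suc d) a = begin
  alternating (suc k) (λ i → fromℕ ((i ℕ.+ a) C suc d))
    ≡⟨ alternating-suc k (λ i → fromℕ ((i ℕ.+ a) C suc d)) ⟩
  alternating k (λ i → fromℕ ((suc i ℕ.+ a) C suc d) - fromℕ ((i ℕ.+ a) C suc d))
    ≡⟨ alternating-cong k (λ i → difference (i ℕ.+ a)) ⟩
  alternating k (λ i → fromℕ ((i ℕ.+ a) C d))
    ≡⟨ alternating-binom k d a ⟩
  fromℕ (binom a (+ d -ℤ + k))
    ≡⟨ cong (fromℕ ∘ binom a) (trans (ℤₚ.m-n≡m⊖n d k)
        (trans (sym (ℤₚ.[1+m]⊖[1+n]≡m⊖n d k)) (sym (ℤₚ.m-n≡m⊖n (suc d) (suc k))))) ⟩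
  fromℕ (binom a (+ suc d -ℤ + suc k)) ∎
  where
  difference : ∀ m → fromℕ (suc m C suc d) - fromℕ (m C suc d) ≡ fromℕ (m C d)
  difference m = begin
    fromℕ (suc m C suc d) - fromℕ (m C suc d)
      ≡⟨ cong (λ c → fromℕ c - fromℕ (m C suc d)) (nCk+nC[k+1]≡[n+1]C[k+1] m d) ⟨
    fromℕ (m C d ℕ.+ m C suc d) - fromℕ (m C suc d)
      ≡⟨ cong (_- fromℕ (m C suc d)) (fromℕ-homo-+ (m C d) (m C suc d)) ⟩
    fromℕ (m C d) + fromℕ (m C suc d) - fromℕ (m C suc d)
      ≡⟨ solve 2 (λ x y → x :+ y :- y := x) refl (fromℕ (m C d)) (fromℕ (m C suc d)) ⟩
    fromℕ (m C d) ∎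

sumSubsets-*-sum : ∀ {k m} (a : Subset k → ℚ) (h : Fin m → ℚ) (b : Fin m → Subset k → ℚ) →
  sumSubsets (λ J → a J * ∑[ j < m ] (h j * b j J)) ≡ ∑[ j < m ] (h j * sumSubsets (λ J → a J * b j J))
sumSubsets-*-sum {ℕ.zero}  {m} a h b = trans (*-distribˡ-sum (a _) (λ j → h j * b j _))
  (sum-cong-≗ {m} λ j → solve 3 (λ a h b → a :* (h :* b) := h :* (a :* b)) refl (a _) (h j) (b j _))
sumSubsets-*-sum {suc k} {m} a h b = trans
  (cong₂ _+_ (sumSubsets-*-sum {k} (a ∘ (inside ∷_)) h (λ j → b j ∘ (inside ∷_)))
             (sumSubsets-*-sum {k} (a ∘ (outside ∷_)) h (λ j → b j ∘ (outside ∷_))))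
  (trans (sym (∑-distrib-+ {m} _ _)) (sum-cong-≗ {m} λ j → sym (ℚₚ.*-distribˡ-+ (h j) _ _)))

alternating-*-sum : ∀ k {m} (h : Fin m → ℚ) (b : Fin m → ℕ → ℚ) →
  alternating k (λ i → ∑[ j < m ] (h j * b j i)) ≡ ∑[ j < m ] (h j * alternating k (b j))
alternating-*-sum k h b =
  sumSubsets-*-sum {k} (λ J → sign (k ∸ ∣ J ∣ₛ)) h (λ j J → b j ∣ J ∣ₛ)

alternating-expand : ∀ k g →
  alternating k g ≡ ∑[ i < suc k ] (sign (k ∸ toℕ i) * fromℕ (k C toℕ i) * g (toℕ i))
alternating-expand k g = trans (sumSubsets-by-size k (λ i → sign (k ∸ i) * g i))
  (sum-cong-≗ {suc k} λ i → solve 3 (λ c s g → c :* (s :* g) := s :* c :* g) refl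
    (fromℕ (k C toℕ i)) (sign (k ∸ toℕ i)) (g (toℕ i)))

-- Dilates of a convex set

module _ {d} (P : LatticePolytope d) where

  -- Needed for `0P = {0}`, since a dilate of the empty set is empty. All the weight is put on the
  -- first generator.
  convexHull-nonempty : ∃ (convexHull P)
  convexHull-nonempty = combination P w , w , w≥0 ,
    ≡⇒≃ {sumᵣ w} {1ℝ} (λ n → cong (_+_ 1ℚ) (sum-0 (size-1 P) n)) ,
    λ c → ≡⇒≃ {combination P w c} {combination P w c} λ _ → refl
    where
    w : Fin (suc (size-1 P)) → ℝ
    w zero    = 1ℝ
    w (suc _) = 0ℝ
    w≥0 : ∀ i → 0ℝ ≤ᵣ w i
    w≥0 zero    = ≤⇒≤ᵣ (ℚₚ.nonNegative⁻¹ 1ℚ)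
    w≥0 (suc _) = ≤⇒≤ᵣ ℚₚ.≤-refl
    sum-0 : ∀ m n → seq (sumᵣ {m} (λ _ → 0ℝ)) n ≡ 0ℚ
    sum-0 zero    n = refl
    sum-0 (suc m) n = trans (ℚₚ.+-identityˡ _) (sum-0 m n)

  convexHull-resp-≋ : ∀ {x y} → x ≋ y → convexHull P y → convexHull P x
  convexHull-resp-≋ {x} {y} x≋y (w , w≥0 , Σw≃1 , y≋) =
    w , w≥0 , Σw≃1 , λ c → ≃-trans {x c} {y c} {combination P w c} (x≋y c) (y≋ c)

  convexHull-convex : ∀ α β .{{_ : NonNegative α}} .{{_ : NonNegative β}} → α + β ≡ 1ℚ →
    ∀ {x y} → convexHull P x → convexHull P y → convexHull P (λ c → α · x c +ᵣ β · y c)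
  convexHull-convex α β α+β≡1 {x} {y} (v , v≥0 , Σv≃1 , x≋) (w , w≥0 , Σw≃1 , y≋) =
    u , u≥0 , Σu≃1 , αx+βy≋
    where
    u : Fin (suc (size-1 P)) → ℝ
    u i = α · v i +ᵣ β · w i
    u≥0 : ∀ i → 0ℝ ≤ᵣ u i
    u≥0 i = +ᵣ-nonNeg {α · v i} {β · w i} (·-nonNeg α {v i} (v≥0 i)) (·-nonNeg β {w i} (w≥0 i))
    Σu≃1 : sumᵣ u ≃ 1ℝ
    Σu≃1 = ≃-trans {sumᵣ u} {α · sumᵣ v +ᵣ β · sumᵣ w} {1ℝ}
      (≡⇒≃ {sumᵣ u} {α · sumᵣ v +ᵣ β · sumᵣ w} λ n → sumᵣ-linear α β u v w n λ _ → refl)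
      (≃-trans {α · sumᵣ v +ᵣ β · sumᵣ w} {α · 1ℝ +ᵣ β · 1ℝ} {1ℝ}
        (+ᵣ-cong {α · sumᵣ v} {α · 1ℝ} {β · sumᵣ w} {β · 1ℝ}
          (·-congʳ α {sumᵣ v} {1ℝ} Σv≃1) (·-congʳ β {sumᵣ w} {1ℝ} Σw≃1))
        (≡⇒≃ {α · 1ℝ +ᵣ β · 1ℝ} {1ℝ} λ _ →
          trans (cong₂ _+_ (ℚₚ.*-identityʳ α) (ℚₚ.*-identityʳ β)) α+β≡1))
    k : Fin d → Fin (suc (size-1 P)) → ℚ
    k c i = fromℤ (lookup (generator P i) c)
    combination-u : ∀ c n →
      seq (combination P u c) n ≡ α * seq (combination P v c) n + β * seq (combination P w c) n
    combination-u c n =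
      sumᵣ-linear α β (λ i → k c i · u i) (λ i → k c i · v i) (λ i → k c i · w i) n λ i →
        solve 5 (λ k α β a b → k :* (α :* a :+ β :* b) := α :* (k :* a) :+ β :* (k :* b)) refl
          (k c i) α β (seq (v i) n) (seq (w i) n)
    αx+βy≋ : (λ c → α · x c +ᵣ β · y c) ≋ combination P u
    αx+βy≋ c = ≃-trans {α · x c +ᵣ β · y c} {α · combination P v c +ᵣ β · combination P w c}
        {combination P u c}
      (+ᵣ-cong {α · x c} {α · combination P v c} {β · y c} {β · combination P w c}
        (·-congʳ α {x c} {combination P v c} (x≋ c)) (·-congʳ β {y c} {combination P w c} (y≋ c)))
      (≡⇒≃ {α · combination P v c +ᵣ β · combination P w c} {combination P u c} λ n →
        sym (combination-u c n))

⊕-cong : ∀ {d} {A A′ B B′ : PointSet d} → (∀ x → A x ⇔ A′ x) → (∀ x → B x ⇔ B′ x) →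
  ∀ x → (A ⊕ B) x ⇔ (A′ ⊕ B′) x
⊕-cong A⇔A′ B⇔B′ x = mk⇔
  (λ (a , b , a∈ , b∈ , x≋) → a , b , to (A⇔A′ a) a∈ , to (B⇔B′ b) b∈ , x≋)
  (λ (a , b , a∈ , b∈ , x≋) → a , b , from (A⇔A′ a) a∈ , from (B⇔B′ b) b∈ , x≋)

-- The weights `m/(m + n)` and `n/(m + n)`, specified without division so that the equations remain
-- meaningful for `m = n = 0`.
record Proportions (m n : ℕ) : Set where
  field
    α β : ℚ
    α≥0 : NonNegative α
    β≥0 : NonNegative β
    α+β : α + β ≡ 1ℚ
    α-scaled : fromℕ (m ℕ.+ n) * α ≡ fromℕ m
    β-scaled : fromℕ (m ℕ.+ n) * β ≡ fromℕ n

fromℕ-nonNeg : ∀ n → NonNegative (fromℕ n)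
fromℕ-nonNeg n = ℚₚ.normalize-nonNeg n 1

proportions : ∀ m n → Proportions m n
-- With total 0 the scaled equations hold for any weights of sum 1; this choice is arbitrary.
proportions zero    zero    = record
  { α = 1ℚ ; β = 0ℚ ; α≥0 = _ ; β≥0 = _ ; α+β = refl ; α-scaled = refl ; β-scaled = refl }
proportions zero    (suc n) = record
  { α = 0ℚ ; β = 1ℚ ; α≥0 = _ ; β≥0 = _ ; α+β = refl
  ; α-scaled = ℚₚ.*-zeroʳ (fromℕ (suc n)) ; β-scaled = ℚₚ.*-identityʳ (fromℕ (suc n)) }
proportions (suc m) n       = record
  { α = fromℕ (suc m) * r ; β = fromℕ n * r
  ; α≥0 = ℚₚ.nonNeg*nonNeg⇒nonNeg (fromℕ (suc m)) {{fromℕ-nonNeg (suc m)}} r {{r≥0}}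
  ; β≥0 = ℚₚ.nonNeg*nonNeg⇒nonNeg (fromℕ n) {{fromℕ-nonNeg n}} r {{r≥0}}
  ; α+β = trans (sym (ℚₚ.*-distribʳ-+ r (fromℕ (suc m)) (fromℕ n)))
            (trans (cong (_* r) (sym (fromℕ-homo-+ (suc m) n))) s*r≡1)
  ; α-scaled = scaled (fromℕ (suc m))
  ; β-scaled = scaled (fromℕ n) }
  where
  s r : ℚ
  s = fromℕ (suc m ℕ.+ n)
  r = + 1 / (suc m ℕ.+ n)
  r≥0 : NonNegative r
  r≥0 = ℚₚ.normalize-nonNeg 1 (suc m ℕ.+ n)
  s*r≡1 : s * r ≡ 1ℚ
  s*r≡1 = fromℕ-*-inverse (suc m ℕ.+ n)
  scaled : ∀ x → s * (x * r) ≡ x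
  scaled x = trans (solve 3 (λ s x r → s :* (x :* r) := (s :* r) :* x) refl s x r)
    (trans (cong (_* x) s*r≡1) (ℚₚ.*-identityˡ x))

module _ {d} (P : LatticePolytope d) where

  -- Joining rewrites `ma + nb` as `(m + n)(αa + βb)`, whose second factor lies in `P` by convexity.
  -- Splitting uses one point `a` for both summands.
  dilate-⊕ : ∀ m n x → (dilate m (convexHull P) ⊕ dilate n (convexHull P)) x
      ⇔ dilate (m ℕ.+ n) (convexHull P) x
  dilate-⊕ m n x = mk⇔ join split
    where
    join : (dilate m (convexHull P) ⊕ dilate n (convexHull P)) x → dilate (m ℕ.+ n) (convexHull P) x
    join (y , z , (a , a∈P , y≋ma) , (b , b∈P , z≋nb) , x≋y+z) =
      (λ c → α · a c +ᵣ β · b c) ,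
      convexHull-convex P α β {{α≥0}} {{β≥0}} α+β {a} {b} a∈P b∈P ,
      λ c → ≃-trans {x c} {y c +ᵣ z c} {fromℕ (m ℕ.+ n) · (α · a c +ᵣ β · b c)} (x≋y+z c)
        (≃-trans {y c +ᵣ z c} {fromℕ m · a c +ᵣ fromℕ n · b c} {fromℕ (m ℕ.+ n) · (α · a c +ᵣ β · b c)}
          (+ᵣ-cong {y c} {fromℕ m · a c} {z c} {fromℕ n · b c} (y≋ma c) (z≋nb c))
          (≡⇒≃ {fromℕ m · a c +ᵣ fromℕ n · b c} {fromℕ (m ℕ.+ n) · (α · a c +ᵣ β · b c)} λ i → trans
            (cong₂ (λ p q → p * seq (a c) i + q * seq (b c) i) (sym α-scaled) (sym β-scaled))
            (solve 5 (λ s α β a b → s :* α :* a :+ s :* β :* b := s :* (α :* a :+ β :* b)) refl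
              (fromℕ (m ℕ.+ n)) α β (seq (a c) i) (seq (b c) i))))
      where open Proportions (proportions m n)
    split : dilate (m ℕ.+ n) (convexHull P) x → (dilate m (convexHull P) ⊕ dilate n (convexHull P)) x
    split (a , a∈P , x≋) =
      (λ c → fromℕ m · a c) , (λ c → fromℕ n · a c) ,
      (a , a∈P , λ c → ≡⇒≃ {fromℕ m · a c} {fromℕ m · a c} λ _ → refl) ,
      (a , a∈P , λ c → ≡⇒≃ {fromℕ n · a c} {fromℕ n · a c} λ _ → refl) ,
      λ c → ≃-trans {x c} {fromℕ (m ℕ.+ n) · a c} {fromℕ m · a c +ᵣ fromℕ n · a c} (x≋ c)
        (≡⇒≃ {fromℕ (m ℕ.+ n) · a c} {fromℕ m · a c +ᵣ fromℕ n · a c} λ i →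
          trans (cong (_* seq (a c) i) (fromℕ-homo-+ m n))
              (ℚₚ.*-distribʳ-+ (seq (a c) i) (fromℕ m) (fromℕ n)))

  dilate-0 : ∀ x → ｛𝟎｝ x ⇔ dilate 0 (convexHull P) x
  dilate-0 x = mk⇔
    (λ x≋0 → let a , a∈P = convexHull-nonempty P in
      a , a∈P , λ c → ≃-trans {x c} {0ℝ} {fromℕ 0 · a c} (x≋0 c)
        (≡⇒≃ {0ℝ} {fromℕ 0 · a c} λ i → sym (ℚₚ.*-zeroˡ (seq (a c) i))))
    (λ (a , _ , x≋0a) c → ≃-trans {x c} {fromℕ 0 · a c} {0ℝ} (x≋0a c)
        (≡⇒≃ {fromℕ 0 · a c} {0ℝ} λ i → ℚₚ.*-zeroˡ (seq (a c) i)))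

  dilate-1 : ∀ x → convexHull P x ⇔ dilate 1 (convexHull P) x
  dilate-1 x = mk⇔
    (λ x∈P → x , x∈P , λ c → ≡⇒≃ {x c} {1ℚ · x c} λ i → sym (ℚₚ.*-identityˡ (seq (x c) i)))
    (λ (a , a∈P , x≋1a) → convexHull-resp-≋ P {x} {a}
      (λ c → ≃-trans {x c} {1ℚ · a c} {a c} (x≋1a c)
          (≡⇒≃ {1ℚ · a c} {a c} λ i → ℚₚ.*-identityˡ (seq (a c) i))) a∈P)

  -- Taking any `A` with the members of `nP` lets the lemma apply both to `dilate n` and to `P`
  -- itself, which has the members of `1P` without being the same predicate.
  minkowski-replicate : ∀ {A} n → (∀ x → A x ⇔ dilate n (convexHull P) x) →
    ∀ {k} (J : Subset k) x → minkowski (replicate k A) J x ⇔ dilate (∣ J ∣ₛ ℕ.* n) (convexHull P) x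
  minkowski-replicate n A⇔nP []            x = dilate-0 x
  minkowski-replicate n A⇔nP (inside  ∷ J) x = ⇔-trans
    (⊕-cong A⇔nP (minkowski-replicate n A⇔nP J) x) (dilate-⊕ n (∣ J ∣ₛ ℕ.* n) x)
  minkowski-replicate n A⇔nP (outside ∷ J) x = minkowski-replicate n A⇔nP J x

-- Lattice point counts and the discrete mixed volume

LatticeCount-cong : ∀ {d} {A B : PointSet d} → (∀ x → A x ⇔ B x) →
  ∀ {c} → LatticeCount A c → LatticeCount B c
LatticeCount-cong A⇔B (xs , uniq , mem , len) = xs , uniq , (λ v → ⇔-trans (mem v) (A⇔B (ι v))) , len

-- Duplicate-free lists with the same members agree as bags, hence are permutations of each other.
LatticeCount-unique : ∀ {d} {A : PointSet d} {m n} → LatticeCount A m → LatticeCount A n → m ≡ n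
LatticeCount-unique (xs , uniq-xs , mem-xs , refl) (ys , uniq-ys , mem-ys , refl) =
  ↭-length (∼bag⇒↭ (unique∧set⇒bag uniq-xs uniq-ys λ {v} → ⇔-trans (mem-xs v) (⇔-sym (mem-ys v))))

-- Left to right, the given counts must be the Ehrhart values by uniqueness; right to left, the
-- enumerations of the dilates provide the counts.
IsDMV-replicate : ∀ {d} (P : LatticePolytope d) {A E} n → (∀ x → A x ⇔ dilate n (convexHull P) x) →
  IsEhrhart (convexHull P) E → ∀ k q →
  IsDMV (replicate k A) q ⇔ q ≡ alternating k (λ i → eval E (fromℕ (i ℕ.* n)))
IsDMV-replicate P {A} {E} n A⇔nP ehrhart k q = mk⇔
  (λ (count , counts , q≡) → trans q≡ (sumSubsets-cong {k} λ J →
    cong (sign (k ∸ ∣ J ∣ₛ) *_) (value J (counts J))))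
  (λ q≡ → (λ J → proj₁ (ehrhart (∣ J ∣ₛ ℕ.* n))) , counts ,
    trans q≡ (sumSubsets-cong {k} λ J → cong (sign (k ∸ ∣ J ∣ₛ) *_) (sym (value J (counts J)))))
  where
  value : ∀ (J : Subset k) {c} → LatticeCount (minkowski (replicate k A) J) c →
    fromℕ c ≡ eval E (fromℕ (∣ J ∣ₛ ℕ.* n))
  value J lattice =
    let c , lattice′ , E≡c = ehrhart (∣ J ∣ₛ ℕ.* n) in
    trans (cong fromℕ (LatticeCount-unique {A = dilate (∣ J ∣ₛ ℕ.* n) (convexHull P)}
      (LatticeCount-cong (minkowski-replicate P n A⇔nP J) lattice) lattice′)) (sym E≡c)
  counts : ∀ (J : Subset k) → LatticeCount (minkowski (replicate k A) J) (proj₁ (ehrhart (∣ J ∣ₛ ℕ.* n)))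
  counts J = LatticeCount-cong (λ x → ⇔-sym (minkowski-replicate P n A⇔nP J x))
    (proj₁ (proj₂ (ehrhart (∣ J ∣ₛ ℕ.* n))))

-- Substituting the h*-expansion

module _ (d : ℕ) (h : Fin (suc d) → ℚ) where

  ehrhartₚ : Poly
  ehrhartₚ = ∑ₚ[ j < suc d ] (h j ·ₚ binomₚ (X +ₚ const (fromℕ d - fromℕ (toℕ j))) d)

  mixedEhrhartₚ : ℕ → Poly
  mixedEhrhartₚ k = ∑ₚ[ j < suc d ] (h j ·ₚ
    ∑ₚ[ i < suc k ] ((sign (k ∸ toℕ i) * fromℕ (k C toℕ i)) ·ₚ
      binomₚ (fromℕ (toℕ i) ·ₚ X +ₚ const (fromℕ d - fromℕ (toℕ j))) d))

  eval-ehrhartₚ : ∀ x → eval ehrhartₚ x ≡ ∑[ j < suc d ] (h j * binomℚ (x + (fromℕ d - fromℕ (toℕ j))) d)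
  eval-ehrhartₚ x = trans (eval-sumₚ (λ j → h j ·ₚ binomₚ (X +ₚ c j) d) x) (sum-cong-≗ {suc d} λ j →
    trans (eval-·ₚ (h j) (binomₚ (X +ₚ c j) d) x) (cong (h j *_)
      (trans (eval-binomₚ (X +ₚ c j) d x) (cong (λ y → binomℚ y d)
        (trans (eval-+ₚ X (c j) x) (cong₂ _+_ (eval-X x) (eval-const (fromℕ d - fromℕ (toℕ j)) x)))))))
    where
    c : Fin (suc d) → Poly
    c j = const (fromℕ d - fromℕ (toℕ j))

  -- At `n` the argument `iX + d − j` takes the value that `X + d − j` takes at `in`. It remains to
  -- exchange the sum over `j` with the alternating sum.
  eval-mixedEhrhartₚ : ∀ k n →
    eval (mixedEhrhartₚ k) (fromℕ n) ≡ alternating k (λ i → eval ehrhartₚ (fromℕ (i ℕ.* n)))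
  eval-mixedEhrhartₚ k n = begin
    eval (mixedEhrhartₚ k) (fromℕ n)
      ≡⟨ eval-sumₚ (λ j → h j ·ₚ inner j) (fromℕ n) ⟩
    ∑[ j < suc d ] eval (h j ·ₚ inner j) (fromℕ n)
      ≡⟨ sum-cong-≗ {suc d} (λ j → trans (eval-·ₚ (h j) (inner j) (fromℕ n))
          (cong (h j *_) (eval-inner j))) ⟩
    ∑[ j < suc d ] (h j * alternating k (b j))
      ≡⟨ alternating-*-sum k h b ⟨
    alternating k (λ i → ∑[ j < suc d ] (h j * b j i))
      ≡⟨ alternating-cong k (λ i → sym (eval-ehrhartₚ (fromℕ (i ℕ.* n)))) ⟩
    alternating k (λ i → eval ehrhartₚ (fromℕ (i ℕ.* n))) ∎
    where
    c : Fin (suc d) → ℚ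
    c j = fromℕ d - fromℕ (toℕ j)
    b : Fin (suc d) → ℕ → ℚ
    b j i = binomℚ (fromℕ (i ℕ.* n) + c j) d
    s : ℕ → ℚ
    s i = sign (k ∸ i) * fromℕ (k C i)
    argument : Fin (suc d) → ℕ → Poly
    argument j i = fromℕ i ·ₚ X +ₚ const (c j)
    inner : Fin (suc d) → Poly
    inner j = ∑ₚ[ i < suc k ] (s (toℕ i) ·ₚ binomₚ (argument j (toℕ i)) d)
    eval-argument : ∀ j i → eval (argument j i) (fromℕ n) ≡ fromℕ (i ℕ.* n) + c j
    eval-argument j i = trans (eval-+ₚ (fromℕ i ·ₚ X) (const (c j)) (fromℕ n)) (cong₂ _+_
      (trans (eval-·ₚ (fromℕ i) X (fromℕ n))
        (trans (cong (fromℕ i *_) (eval-X (fromℕ n))) (sym (fromℕ-homo-* i n))))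
      (eval-const (c j) (fromℕ n)))
    eval-inner : ∀ j → eval (inner j) (fromℕ n) ≡ alternating k (b j)
    eval-inner j = begin
      eval (inner j) (fromℕ n)
        ≡⟨ eval-sumₚ {suc k} (λ i → s (toℕ i) ·ₚ binomₚ (argument j (toℕ i)) d) (fromℕ n) ⟩
      ∑[ i < suc k ] eval (s (toℕ i) ·ₚ binomₚ (argument j (toℕ i)) d) (fromℕ n)
        ≡⟨ sum-cong-≗ {suc k} (λ i → trans (eval-·ₚ (s (toℕ i)) (binomₚ (argument j (toℕ i)) d) (fromℕ n))
             (cong (s (toℕ i) *_) (trans (eval-binomₚ (argument j (toℕ i)) d (fromℕ n))
               (cong (λ y → binomℚ y d) (eval-argument j (toℕ i)))))) ⟩
      ∑[ i < suc k ] (s (toℕ i) * b j (toℕ i))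
        ≡⟨ alternating-expand k (b j) ⟨
      alternating k (b j) ∎

  alternating-ehrhartₚ : ∀ k → alternating k (λ i → eval ehrhartₚ (fromℕ (i ℕ.* 1))) ≡
    ∑[ j < suc d ] (fromℕ (binom (d ∸ toℕ j) (+ d -ℤ + k)) * h j)
  alternating-ehrhartₚ k = begin
    alternating k (λ i → eval ehrhartₚ (fromℕ (i ℕ.* 1)))
      ≡⟨ alternating-cong k (λ i → trans (eval-ehrhartₚ (fromℕ (i ℕ.* 1)))
           (sum-cong-≗ {suc d} (λ j → cong (h j *_) (binomial i j)))) ⟩
    alternating k (λ i → ∑[ j < suc d ] (h j * fromℕ ((i ℕ.+ (d ∸ toℕ j)) C d)))
      ≡⟨ alternating-*-sum k h (λ j i → fromℕ ((i ℕ.+ (d ∸ toℕ j)) C d)) ⟩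
    ∑[ j < suc d ] (h j * alternating k (λ i → fromℕ ((i ℕ.+ (d ∸ toℕ j)) C d)))
      ≡⟨ sum-cong-≗ {suc d} (λ j → trans (cong (h j *_) (alternating-binom k d (d ∸ toℕ j)))
           (ℚₚ.*-comm (h j) (fromℕ (binom (d ∸ toℕ j) (+ d -ℤ + k))))) ⟩
    ∑[ j < suc d ] (fromℕ (binom (d ∸ toℕ j) (+ d -ℤ + k)) * h j) ∎
    where
    binomial : ∀ i (j : Fin (suc d)) →
      binomℚ (fromℕ (i ℕ.* 1) + (fromℕ d - fromℕ (toℕ j))) d ≡ fromℕ ((i ℕ.+ (d ∸ toℕ j)) C d)
    binomial i j = begin
      binomℚ (fromℕ (i ℕ.* 1) + (fromℕ d - fromℕ (toℕ j))) d
        -- Since `j ≤ d`, the rational `d − j` is the natural number `d ∸ j`, and the polynomial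
        -- binomial becomes an ordinary one.
        ≡⟨ cong₂ (λ l y → binomℚ (fromℕ l + y) d) (ℕₚ.*-identityʳ i)
             (sym (fromℕ-homo-∸ (Finₚ.toℕ≤pred[n] j))) ⟩
      binomℚ (fromℕ i + fromℕ (d ∸ toℕ j)) d
        ≡⟨ cong (λ y → binomℚ y d) (fromℕ-homo-+ i (d ∸ toℕ j)) ⟨
      binomℚ (fromℕ (i ℕ.+ (d ∸ toℕ j))) d
        ≡⟨ binomℚ-fromℕ (i ℕ.+ (d ∸ toℕ j)) d ⟩
      fromℕ ((i ℕ.+ (d ∸ toℕ j)) C d) ∎

proposition2p7 : ∀ (d k : ℕ) → 1 ≤ d → 1 ≤ k →
    (P : LatticePolytope d) → FullDimensional P →
    (h : Fin (suc d) → ℚ) → IsHStarVector P h →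
    (∀ (M : Poly) → IsMixedEhrhart (replicate k (convexHull P)) M ⇔
    (M ≈ₚ ∑ₚ[ j < suc d ] (h j ·ₚ
    ∑ₚ[ i < suc k ] ((sign (k ∸ toℕ i) * fromℕ (k C toℕ i)) ·ₚ
    binomₚ (fromℕ (toℕ i) ·ₚ X +ₚ const (fromℕ d - fromℕ (toℕ j))) d))))
    ×
    (∀ (q : ℚ) → IsDMV (replicate k (convexHull P)) q ⇔
    (q ≡ ∑[ j < suc d ] (fromℕ (binom (d ∸ toℕ j) (+ d -ℤ + k)) * h j)))
proposition2p7 d k _ _ P _ h (E , ehrhart , E≈) =
  (λ M → mk⇔
    (λ mixed → polynomial-identity M (mixedEhrhartₚ d h k) λ n →
      -- `IsMixedEhrhart` dilates the vector entrywise; `map-replicate` turns the result into `k`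
      -- copies of `nP`.
      trans (to (at n _) (subst (λ As → IsDMV As (eval M (fromℕ n)))
          (map-replicate (dilate n) (convexHull P) k) (mixed n)))
        (value n))
    (λ M≈ n → subst (λ As → IsDMV As (eval M (fromℕ n))) (sym (map-replicate (dilate n) (convexHull P) k))
      (from (at n _) (trans (eval-resp-≈ₚ M (mixedEhrhartₚ d h k) M≈ (fromℕ n)) (sym (value n)))))) ,
  λ q → mk⇔ (λ dmv → trans (to (at-1 q) dmv) value-1) (λ q≡ → from (at-1 q) (trans q≡ (sym value-1)))
  where
  at : ∀ n q → IsDMV (replicate k (dilate n (convexHull P))) q ⇔
      q ≡ alternating k (λ i → eval E (fromℕ (i ℕ.* n)))
  at n = IsDMV-replicate P {E = E} n (λ _ → ⇔-refl) ehrhart k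
  at-1 : ∀ q → IsDMV (replicate k (convexHull P)) q ⇔
      q ≡ alternating k (λ i → eval E (fromℕ (i ℕ.* 1)))
  at-1 = IsDMV-replicate P {E = E} 1 (dilate-1 P) ehrhart k
  eval-E : ∀ n → alternating k (λ i → eval E (fromℕ (i ℕ.* n))) ≡
      alternating k (λ i → eval (ehrhartₚ d h) (fromℕ (i ℕ.* n)))
  eval-E n = alternating-cong k λ i → eval-resp-≈ₚ E (ehrhartₚ d h) E≈ (fromℕ (i ℕ.* n))
  value : ∀ n → alternating k (λ i → eval E (fromℕ (i ℕ.* n))) ≡
      eval (mixedEhrhartₚ d h k) (fromℕ n)
  value n = trans (eval-E n) (sym (eval-mixedEhrhartₚ d h k n))
  value-1 = trans (eval-E 1) (alternating-ehrhartₚ d h k)
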